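{- Let $T$ be a theory that is axiomatically appropriate, schematic, and supports weakening. Then there exists a realization $r$ such that for every formula $A$ of the language of modal logic, if $\vdash_{\mathsf{K}} A$ then $T\vdash_{\mathsf{SE}} r(A)$.
   Context: Syntax of $\mathsf{SE}$. There are countably infinite sets of justification constants $\mathsf{JConst}=\{0,1,c_1,c_2,\dots\}$ and justification variables $\mathsf{JVar}=\{x_1,x_2,\dots\}$. Terms: constants, variables, and $s\cdot t$, $s+t$ for terms $s,t$; a ground term is one without variables. Formulas: $\bot$, atomic propositions $P\in\mathsf{Prop}$, $A\to B$, and $t:A$; $\neg,\wedge,\vee,\leftrightarrow$ are abbreviations. $A[w/t]$ is simultaneous replacement of the variable $w$ by term $t$. Axioms of $\mathsf{SE}$ (the axiom schemes, for arbitrary formulas $A,B$ and variables $w,x,y,z$): (CL) propositional tautologies; (j) $x:(A\to B)\to(y:A\to x\cdot y:B)$; (j+) $x:A\wedge y:A\to(x+y):A$; (a+) $A[w/(x+y)+z]\to A[w/x+(y+z)]$; (c+) $A[w/x+y]\to A[w/y+x]$; (0+) $A[w/x+0]\leftrightarrow A[w/x]$; (am) $A[w/(x\cdot y)\cdot z]\leftrightarrow A[w/x\cdot(y\cdot z)]$; (a0) $A[w/x\cdot 0]\leftrightarrow A[w/0]$, $A[w/0\cdot x]\leftrightarrow A[w/0]$; (a1) $A[w/x\cdot 1]\leftrightarrow A[w/x]$, $A[w/1\cdot x]\leftrightarrow A[w/x]$; (dl) $A[w/x\cdot(y+z)]\leftrightarrow A[w/x\cdot y+x\cdot z]$; (dr)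 $A[w/(y+z)\cdot x]\leftrightarrow A[w/y\cdot x+z\cdot x]$. Rules: modus ponens and (jv): from $A$ infer $A[x/t]$. $T\vdash_{\mathsf{SE}}F$: $F$ derivable from axioms and members of the set $T$ by these rules. A theory $T$ is axiomatically appropriate if for every axiom $A$ there is a constant $c$ with $c:A\in T$, and for every $B\in T$ there is a constant $c$ with $c:B\in T$. $T$ is schematic if for each constant $c$, the set $\{A\mid c:A\in T \text{ and } A \text{ is an axiom}\}$ consists of all instances of one or several (possibly zero) axiom schemes of $\mathsf{SE}$. $T$ supports weakening if there is a ground term $t$ such that for all formulas $A,B$: $t:(A\to A\vee B)\in T$ and $t:(B\to A\vee B)\in T$. $\mathsf{K}$ is the basic normal modal logic; $\vdash_{\mathsf{K}}A$ means $A$ is a theorem (valid) in $\mathsf{K}$. For a formula $A$ of $\mathsf{SE}$, $A^\circ$ is the modal formula obtained by replacing every occurrence of $s:$ (for any term $s$) by $\Box$. A realization is a mapping $r$ from modal formulas to formulas of $\mathsf{SE}$ such that $(r(F))^\circ=F$ for every modal formula $F$. -}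

module Defs where

open import Data.Nat using (ℕ; _≡ᵇ_)
open import Data.Bool using (Bool; true; false; if_then_else_; not; _∨_)
open import Data.Product using (Σ; _×_; _,_)
open import Data.Sum using (_⊎_)
open import Relation.Binary.PropositionalEquality using (_≡_)
open import Function.Bundles using (_⇔_)

data Const : Set where
  c0 : Const
  c1 : Const
  cₙ : ℕ → Const

data Tm : Set where
  con : Const → Tm
  var : ℕ → Tm
  _·_ : Tm → Tm → Tm
  _⊕_ : Tm → Tm → Tm

infixl 7 _·_
infixl 6 _⊕_

`0 `1 : Tm
`0 = con c0
`1 = con c1

data Ground : Tm → Set where
  con : ∀ c → Ground (con c)
  _·_ : ∀ {s t} → Ground s → Ground t → Ground (s · t)
  _⊕_ : ∀ {s t} → Ground s → Ground t → Ground (s ⊕ t)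

data Fm : Set where
  ⊥ₛ  : Fm
  atm : ℕ → Fm
  _⇒_ : Fm → Fm → Fm
  _∶_ : Tm → Fm → Fm

infixr 4 _⇒_
infix 5 _∶_

¬ₛ_ : Fm → Fm
¬ₛ A = A ⇒ ⊥ₛ

_∧ₛ_ : Fm → Fm → Fm
A ∧ₛ B = ¬ₛ (A ⇒ ¬ₛ B)

_∨ₛ_ : Fm → Fm → Fm
A ∨ₛ B = (¬ₛ A) ⇒ B

_⇔ₛ_ : Fm → Fm → Fm
A ⇔ₛ B = (A ⇒ B) ∧ₛ (B ⇒ A)

infixr 6 _∧ₛ_
infixr 6 _∨ₛ_
infix 3 _⇔ₛ_

substT : Tm → ℕ → Tm → Tm
substT (con c) w t = con c
substT (var x) w t = if x ≡ᵇ w then t else var x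
substT (s · u) w t = substT s w t · substT u w t
substT (s ⊕ u) w t = substT s w t ⊕ substT u w t

_[_≔_] : Fm → ℕ → Tm → Fm
⊥ₛ [ w ≔ t ] = ⊥ₛ
atm P [ w ≔ t ] = atm P
(A ⇒ B) [ w ≔ t ] = (A [ w ≔ t ]) ⇒ (B [ w ≔ t ])
(s ∶ A) [ w ≔ t ] = substT s w t ∶ (A [ w ≔ t ])

-- Propositional tautologies: atoms P and justification assertions t:A
-- are treated as propositional atoms.

evalₛ : (ℕ → Bool) → (Tm → Fm → Bool) → Fm → Bool
evalₛ p q ⊥ₛ = false
evalₛ p q (atm P) = p P
evalₛ p q (A ⇒ B) = not (evalₛ p q A) ∨ evalₛ p q B
evalₛ p q (t ∶ A) = q t A

Tautₛ : Fm → Set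
Tautₛ A = ∀ (p : ℕ → Bool) (q : Tm → Fm → Bool) → evalₛ p q A ≡ true

data Scheme : Set where
  sCL sj sj+ sa+ sc+ s0+ sam sa0 sa1 sdl sdr : Scheme

data Instance : Scheme → Fm → Set where
  CL  : ∀ {A} → Tautₛ A → Instance sCL A
  j   : ∀ A B x y →
        Instance sj ((var x ∶ (A ⇒ B)) ⇒ ((var y ∶ A) ⇒ (var x · var y ∶ B)))
  j+  : ∀ A x y →
        Instance sj+ (((var x ∶ A) ∧ₛ (var y ∶ A)) ⇒ (var x ⊕ var y ∶ A))
  a+  : ∀ A w x y z →
        Instance sa+ ((A [ w ≔ (var x ⊕ var y) ⊕ var z ]) ⇒ (A [ w ≔ var x ⊕ (var y ⊕ var z) ]))
  c+  : ∀ A w x y →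
        Instance sc+ ((A [ w ≔ var x ⊕ var y ]) ⇒ (A [ w ≔ var y ⊕ var x ]))
  0+  : ∀ A w x →
        Instance s0+ ((A [ w ≔ var x ⊕ `0 ]) ⇔ₛ (A [ w ≔ var x ]))
  am  : ∀ A w x y z →
        Instance sam ((A [ w ≔ (var x · var y) · var z ]) ⇔ₛ (A [ w ≔ var x · (var y · var z) ]))
  a0r : ∀ A w x →
        Instance sa0 ((A [ w ≔ var x · `0 ]) ⇔ₛ (A [ w ≔ `0 ]))
  a0l : ∀ A w x →
        Instance sa0 ((A [ w ≔ `0 · var x ]) ⇔ₛ (A [ w ≔ `0 ]))
  a1r : ∀ A w x →
        Instance sa1 ((A [ w ≔ var x · `1 ]) ⇔ₛ (A [ w ≔ var x ]))
  a1l : ∀ A w x →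
        Instance sa1 ((A [ w ≔ `1 · var x ]) ⇔ₛ (A [ w ≔ var x ]))
  dl  : ∀ A w x y z →
        Instance sdl ((A [ w ≔ var x · (var y ⊕ var z) ]) ⇔ₛ (A [ w ≔ var x · var y ⊕ var x · var z ]))
  dr  : ∀ A w x y z →
        Instance sdr ((A [ w ≔ (var y ⊕ var z) · var x ]) ⇔ₛ (A [ w ≔ var y · var x ⊕ var z · var x ]))

Axiom : Fm → Set
Axiom A = Σ Scheme λ s → Instance s A

Theory : Set₁
Theory = Fm → Set

data _⊢_ (T : Theory) : Fm → Set where
  ax  : ∀ {A} → Axiom A → T ⊢ A
  hyp : ∀ {A} → T A → T ⊢ A
  mp  : ∀ {A B} → T ⊢ (A ⇒ B) → T ⊢ A → T ⊢ B
  jv  : ∀ {A} x t → T ⊢ A → T ⊢ (A [ x ≔ t ])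

infix 2 _⊢_

AxiomaticallyAppropriate : Theory → Set
AxiomaticallyAppropriate T =
  (∀ A → Axiom A → Σ Const λ c → T (con c ∶ A)) ×
  (∀ B → T B → Σ Const λ c → T (con c ∶ B))

Schematic : Theory → Set₁
Schematic T =
  ∀ (c : Const) → Σ (Scheme → Set) λ S →
    ∀ A → ((T (con c ∶ A) × Axiom A) ⇔ (Σ Scheme λ s → S s × Instance s A))

SupportsWeakening : Theory → Set
SupportsWeakening T =
  Σ Tm λ t → Ground t ×
    (∀ A B → T (t ∶ (A ⇒ (A ∨ₛ B))) × T (t ∶ (B ⇒ (A ∨ₛ B))))

data MFm : Set where
  ⊥ₘ   : MFm
  atmₘ : ℕ → MFm
  _⇒ₘ_ : MFm → MFm → MFm
  □_   : MFm → MFm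

infixr 4 _⇒ₘ_
infix 5 □_

evalₘ : (ℕ → Bool) → (MFm → Bool) → MFm → Bool
evalₘ p q ⊥ₘ = false
evalₘ p q (atmₘ P) = p P
evalₘ p q (A ⇒ₘ B) = not (evalₘ p q A) ∨ evalₘ p q B
evalₘ p q (□ A) = q A

Tautₘ : MFm → Set
Tautₘ A = ∀ (p : ℕ → Bool) (q : MFm → Bool) → evalₘ p q A ≡ true

data ⊢K : MFm → Set where
  taut : ∀ {A} → Tautₘ A → ⊢K A
  kax  : ∀ A B → ⊢K (□ (A ⇒ₘ B) ⇒ₘ (□ A ⇒ₘ □ B))
  mp   : ∀ {A B} → ⊢K (A ⇒ₘ B) → ⊢K A → ⊢K B
  nec  : ∀ {A} → ⊢K A → ⊢K (□ A)

_° : Fm → MFm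
⊥ₛ ° = ⊥ₘ
atm P ° = atmₘ P
(A ⇒ B) ° = (A °) ⇒ₘ (B °)
(t ∶ A) ° = □ (A °)

IsRealization : (MFm → Fm) → Set
IsRealization r = ∀ F → (r F) ° ≡ F

{-# OPTIONS --safe #-}

-- Realize □B by t ∶ B′, where B′ realizes B and t internalizes a proof of B′ if
-- B is a theorem of K, and t = 0 otherwise.  When
-- G₁ → … → Gₖ → D is a theorem, its image t₁:G₁ → … → tₖ:Gₖ → s:D must be derivable,
-- which is clear unless s = 0.  If some tᵢ is 0, then an internalized proof u of the theorem gives
-- u·t₁·…·tₖ as a justification of D, and this is 0 since 0 is absorbing for ·.  If no tᵢ is 0, then all Gᵢ are theorems
-- of K, and so any countermodel of D is one of G₁ → … → Gₖ → D.
-- The required dichotomy between theorems and formulas with a countermodel comes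
-- from a tableau search by recursion on the modal depth; it runs on the realized
-- formulas, so that a closed tableau yields a proof from T.

module Submission where

open import Defs
open import Data.Bool using (Bool; true; false; not; _∧_; _∨_)
open import Data.Bool.Properties using (∧-zeroʳ)
open import Data.Empty using (⊥; ⊥-elim)
open import Data.List using (List; []; _∷_; map; foldr)
open import Data.List.Membership.DecPropositional using (_∈?_)
open import Data.List.Membership.Propositional using (find)
open import Data.List.Relation.Unary.All as All using (All; []; _∷_)
open import Data.List.Relation.Unary.All.Properties using (map⁺; map⁻; ¬Any⇒All¬)
open import Data.List.Relation.Unary.Any using (Any; here; there; any?)
open import Data.Nat using (ℕ; zero; suc; _≤_; _<_; _⊔_; _≡ᵇ_; _≟_; s≤s; s≤s⁻¹)
open import Data.Nat.Properties using (≤-refl; ≤-trans; m≤n⇒m≤1+n; m≤m⊔n; m≤n⊔m; m⊔n≤o⇒m≤o; m⊔n≤o⇒n≤o)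
open import Data.Product using (Σ; _×_; _,_; proj₁; proj₂)
open import Data.Sum using (_⊎_; inj₁; inj₂)
open import Data.Unit using (⊤; tt)
open import Relation.Binary.PropositionalEquality using (_≡_; refl; sym; trans; cong; cong₂; subst)
open import Relation.Nullary using (¬_; does; yes; no)
open import Relation.Nullary.Decidable using (dec-true; dec-false)

-- Valuations

Valuation : Set
Valuation = (ℕ → Bool) × (Tm → Fm → Bool)

ev : Valuation → Fm → Bool
ev (p , q) = evalₛ p q

true≢false : ∀ {b} → b ≡ true → b ≡ false → ⊥
true≢false refl ()

⇒-elim : ∀ {a b} → not a ∨ b ≡ true → a ≡ true → b ≡ true
⇒-elim e refl = e

⇒-intro : ∀ {a b} → (a ≡ true → b ≡ true) → not a ∨ b ≡ true
⇒-intro {true}  f = f refl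
⇒-intro {false} f = refl

⇒-false⁻ : ∀ {a b} → not a ∨ b ≡ false → a ≡ true × b ≡ false
⇒-false⁻ {true} e = refl , e

⇒-true⁻ : ∀ {a b} → not a ∨ b ≡ true → a ≡ false ⊎ b ≡ true
⇒-true⁻ {true}  e = inj₂ e
⇒-true⁻ {false} e = inj₁ refl

⇒-false⁺ : ∀ {a b} → a ≡ true → b ≡ false → not a ∨ b ≡ false
⇒-false⁺ refl refl = refl

⇒-trueˡ : ∀ {a b} → a ≡ false → not a ∨ b ≡ true
⇒-trueˡ refl = refl

∧ₛ-elim : ∀ v A B → ev v (A ∧ₛ B) ≡ true → ev v A ≡ true × ev v B ≡ true
∧ₛ-elim v A B with ev v A | ev v B
... | true  | true  = λ _ → refl , refl
... | true  | false = λ ()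
... | false | true  = λ ()
... | false | false = λ ()

∧ₛ-intro : ∀ v A B → ev v A ≡ true → ev v B ≡ true → ev v (A ∧ₛ B) ≡ true
∧ₛ-intro v A B with ev v A | ev v B
... | true | true = λ _ _ → refl
... | true | false = λ _ ()
... | false | _ = λ ()

⇒-taut : ∀ {A B} → (∀ v → ev v A ≡ true → ev v B ≡ true) → Tautₛ (A ⇒ B)
⇒-taut f p q = ⇒-intro (f (p , q))

_⇛_ : List Fm → Fm → Fm
As ⇛ B = foldr _⇒_ B As

⇛-elim : ∀ {v} As {B} → ev v (As ⇛ B) ≡ true → All (λ A → ev v A ≡ true) As → ev v B ≡ true
⇛-elim []       e []       = e
⇛-elim (A ∷ As) e (a ∷ as) = ⇛-elim As (⇒-elim e a) as

⇛-intro : ∀ {v} As {B} → (All (λ A → ev v A ≡ true) As → ev v B ≡ true) → ev v (As ⇛ B) ≡ true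
⇛-intro []       f = f []
⇛-intro (A ∷ As) f = ⇒-intro λ a → ⇛-intro As λ as → f (a ∷ as)

-- Models of K

-- Instead of a set of successor worlds, a model only records which formulas hold
-- at all of them.
record Frame : Set where
  field
    box      : MFm → Bool
    box-nec  : ∀ {A} → ⊢K A → box A ≡ true
    box-dist : ∀ {A B} → box (A ⇒ₘ B) ≡ true → box A ≡ true → box B ≡ true

open Frame

Model : Set
Model = (ℕ → Bool) × Frame

holds : Model → MFm → Bool
holds (p , f) = evalₘ p (box f)

sound : ∀ M {A} → ⊢K A → holds M A ≡ true
sound (p , f) (taut t)  = t p (box f)
sound (p , f) (kax A B) = ⇒-intro λ ab → ⇒-intro λ a → box-dist f ab a
sound M       (mp d e)  = ⇒-elim (sound M d) (sound M e)
sound (p , f) (nec d)   = box-nec f d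

noWorlds : Frame
noWorlds = record { box = λ _ → true ; box-nec = λ _ → refl ; box-dist = λ _ _ → refl }

∧-true⁻ : ∀ {a b} → a ∧ b ≡ true → a ≡ true × b ≡ true
∧-true⁻ {true} e = refl , e

∧-true⁺ : ∀ {a b} → a ≡ true → b ≡ true → a ∧ b ≡ true
∧-true⁺ refl refl = refl

∧-falseˡ : ∀ {a b} → a ≡ false → a ∧ b ≡ false
∧-falseˡ refl = refl

∧-falseʳ : ∀ {a b} → b ≡ false → a ∧ b ≡ false
∧-falseʳ {a} refl = ∧-zeroʳ a

-- The boxes of a world that sees `M` in addition to the successors behind `f`. Soundness at `M` is
-- what keeps `box-nec` true.
addWorld : Model → Frame → Frame
addWorld M f = record
  { box      = λ A → holds M A ∧ box f A
  ; box-nec  = λ d → ∧-true⁺ (sound M d) (box-nec f d)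
  ; box-dist = λ ab a → let ab₁ , ab₂ = ∧-true⁻ ab ; a₁ , a₂ = ∧-true⁻ a in
                 ∧-true⁺ (⇒-elim ab₁ a₁) (box-dist f ab₂ a₂)
  }

-- Ignoring the terms makes evaluation commute with `_°`. Modal models can thus falsify realized
-- formulas directly, and tautologies of SE project to modal tautologies.
forget : (ℕ → Bool) → (MFm → Bool) → Valuation
forget p q = p , λ _ A → q (A °)

ev-forget : ∀ p q A → ev (forget p q) A ≡ evalₘ p q (A °)
ev-forget p q ⊥ₛ      = refl
ev-forget p q (atm x) = refl
ev-forget p q (A ⇒ B) = cong₂ (λ a b → not a ∨ b) (ev-forget p q A) (ev-forget p q B)
ev-forget p q (t ∶ A) = refl

val : Model → Valuation
val (p , f) = forget p (box f)

ev-val : ∀ M A → ev (val M) A ≡ holds M (A °)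
ev-val (p , f) = ev-forget p (box f)

Tautₛ⇒Tautₘ : ∀ A → Tautₛ A → Tautₘ (A °)
Tautₛ⇒Tautₘ A t p q = let p′ , q′ = forget p q in trans (sym (ev-forget p q A)) (t p′ q′)

Counter : Fm → Set
Counter A = Σ Model λ M → ev (val M) A ≡ false

Counter⇒⊬K : ∀ {A} → Counter A → ¬ ⊢K (A °)
Counter⇒⊬K {A} (M , e) d = true≢false (trans (ev-val M A) (sound M d)) e

-- Fresh variables

boundT : Tm → ℕ
boundT (con c) = 0
boundT (var x) = suc x
boundT (s · t) = boundT s ⊔ boundT t
boundT (s ⊕ t) = boundT s ⊔ boundT t

bound : Fm → ℕ
bound ⊥ₛ      = 0
bound (atm x) = 0
bound (A ⇒ B) = bound A ⊔ bound B
bound (t ∶ A) = boundT t ⊔ bound A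

<⇒≡ᵇ-false : ∀ {x w} → x < w → (x ≡ᵇ w) ≡ false
<⇒≡ᵇ-false {zero}  (s≤s _) = refl
<⇒≡ᵇ-false {suc x} (s≤s l) = <⇒≡ᵇ-false l

≡ᵇ-refl : ∀ x → (x ≡ᵇ x) ≡ true
≡ᵇ-refl zero    = refl
≡ᵇ-refl (suc x) = ≡ᵇ-refl x

substT-fresh : ∀ s {w t} → boundT s ≤ w → substT s w t ≡ s
substT-fresh (con c) l = refl
substT-fresh (var x) l rewrite <⇒≡ᵇ-false l = refl
substT-fresh (s · u) l = cong₂ _·_ (substT-fresh s (m⊔n≤o⇒m≤o _ _ l)) (substT-fresh u (m⊔n≤o⇒n≤o _ _ l))
substT-fresh (s ⊕ u) l = cong₂ _⊕_ (substT-fresh s (m⊔n≤o⇒m≤o _ _ l)) (substT-fresh u (m⊔n≤o⇒n≤o _ _ l))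

subst-fresh : ∀ A {w t} → bound A ≤ w → A [ w ≔ t ] ≡ A
subst-fresh ⊥ₛ      l = refl
subst-fresh (atm x) l = refl
subst-fresh (A ⇒ B) l = cong₂ _⇒_ (subst-fresh A (m⊔n≤o⇒m≤o _ _ l)) (subst-fresh B (m⊔n≤o⇒n≤o _ _ l))
subst-fresh (s ∶ A) l = cong₂ _∶_ (substT-fresh s (m⊔n≤o⇒m≤o _ _ l)) (subst-fresh A (m⊔n≤o⇒n≤o _ _ l))

substT-var : ∀ w {t} → substT (var w) w t ≡ t
substT-var w rewrite ≡ᵇ-refl w = refl

-- Derivability from T

⊢-consequence : ∀ {T A B} → (∀ v → ev v A ≡ true → ev v B ≡ true) → T ⊢ A → T ⊢ B
⊢-consequence {_} {A} {B} f d = mp (ax (sCL , CL (⇒-taut {A} {B} f))) d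

-- The scheme `j` speaks of variables only; arbitrary terms are obtained by applying `jv` to two
-- fresh variables, first `x`, then `y`.
⊢-app : ∀ {T} s t A B → T ⊢ ((s ∶ (A ⇒ B)) ⇒ ((t ∶ A) ⇒ (s · t ∶ B)))
⊢-app {T} s t A B = subst (T ⊢_) eq₂ (jv y t (subst (T ⊢_) eq₁ (jv x s (ax (sj , j A B x y)))))
  where
  -- When `t` replaces `y`, the term `s` is already in place, so `y` must be fresh for `s` too. The
  -- successor of `y` is fresh for `A` and `B` and differs from `y`.
  y x : ℕ
  y = bound (A ⇒ B) ⊔ boundT s
  x = suc y

  A≤y : bound A ≤ y
  A≤y = ≤-trans (m≤m⊔n _ _) (m≤m⊔n _ _)

  B≤y : bound B ≤ y
  B≤y = ≤-trans (m≤n⊔m (bound A) _) (m≤m⊔n _ _)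

  formula : Tm → Tm → Fm → Fm → Fm
  formula s t A B = (s ∶ (A ⇒ B)) ⇒ ((t ∶ A) ⇒ (s · t ∶ B))

  formula-cong : ∀ {s s′ t t′ A A′ B B′} → s ≡ s′ → t ≡ t′ → A ≡ A′ → B ≡ B′ →
                 formula s t A B ≡ formula s′ t′ A′ B′
  formula-cong refl refl refl refl = refl

  eq₁ : formula (var x) (var y) A B [ x ≔ s ] ≡ formula s (var y) A B
  eq₁ = formula-cong (substT-var x) (substT-fresh (var y) ≤-refl)
          (subst-fresh A (m≤n⇒m≤1+n A≤y)) (subst-fresh B (m≤n⇒m≤1+n B≤y))

  eq₂ : formula s (var y) A B [ y ≔ t ] ≡ formula s t A B
  eq₂ = formula-cong (substT-fresh s (m≤n⊔m (bound (A ⇒ B)) _)) (substT-var y)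
          (subst-fresh A A≤y) (subst-fresh B B≤y)

⇔ₛ-elimˡ : ∀ {T A B} → T ⊢ (A ⇔ₛ B) → T ⊢ (A ⇒ B)
⇔ₛ-elimˡ {_} {A} {B} = ⊢-consequence λ v e → proj₁ (∧ₛ-elim v (A ⇒ B) (B ⇒ A) e)

module _ {T : Theory} (A : Fm) where
  private
    w : ℕ
    w = bound A

    fresh : ∀ {t} → A [ w ≔ t ] ≡ A
    fresh = subst-fresh A ≤-refl

    fresh² : ∀ {s t} → (A [ w ≔ s ]) [ w ≔ t ] ≡ A
    fresh² {s} {t} = trans (cong (_[ w ≔ t ]) fresh) fresh

    hole : ∀ {s t} → substT (substT (var w) w s) w t ≡ substT s w t
    hole {_} {t} = cong (λ u → substT u w t) (substT-var w)

  -- The scheme `a0r` is applied to `var w ∶ A` with `w` fresh for `A`, so that the replacement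
  -- affects only the outer term. The same `w` serves as the variable of the axiom, and `jv` then
  -- turns it into `t`.
  ⊢-zeroʳ : ∀ t → T ⊢ ((t · `0 ∶ A) ⇒ (`0 ∶ A))
  ⊢-zeroʳ t = subst (T ⊢_)
    (cong₂ _⇒_ (cong₂ _∶_ (trans hole (cong (_· `0) (substT-var w))) fresh²) (cong₂ _∶_ hole fresh²))
    (jv w t (⇔ₛ-elimˡ (ax (sa0 , a0r (var w ∶ A) w w))))

  ⊢-zeroˡ : ∀ t → T ⊢ ((`0 · t ∶ A) ⇒ (`0 ∶ A))
  ⊢-zeroˡ t = subst (T ⊢_)
    (cong₂ _⇒_ (cong₂ _∶_ (trans hole (cong (`0 ·_) (substT-var w))) fresh²) (cong₂ _∶_ hole fresh²))
    (jv w t (⇔ₛ-elimˡ (ax (sa0 , a0l (var w ∶ A) w w))))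

depth : Fm → ℕ
depth ⊥ₛ      = 0
depth (atm x) = 0
depth (A ⇒ B) = depth A ⊔ depth B
depth (t ∶ A) = suc (depth A)

-- Internalization, provability and the choice of terms

module Realization (T : Theory) (appropriate : AxiomaticallyAppropriate T) where

  -- Induction on the derivation: constants come from axiomatic appropriateness, modus ponens
  -- becomes application, and `jv` applies to the justified formula as a whole, substituting in its
  -- term as well.
  internalize : ∀ {A} → T ⊢ A → Σ Tm λ u → T ⊢ (u ∶ A)
  internalize (ax a)  = let c , h = proj₁ appropriate _ a in con c , hyp h
  internalize (hyp h) = let c , h′ = proj₂ appropriate _ h in con c , hyp h′
  internalize (mp {A} {B} d e) =
    let s , d′ = internalize d ; t , e′ = internalize e in
    s · t , mp (mp (⊢-app s t A B) d′) e′
  internalize (jv x t d) = let u , d′ = internalize d in substT u x t , jv x t d′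

  -- Since `T` is arbitrary, derivability from it need not project to a theorem of K; the two proofs
  -- are therefore built side by side.
  Prov : Fm → Set
  Prov A = (T ⊢ A) × ⊢K (A °)

  prov-taut : ∀ {A} → Tautₛ A → Prov A
  prov-taut {A} t = ax (sCL , CL t) , taut (Tautₛ⇒Tautₘ A t)

  prov-mp : ∀ {A B} → Prov (A ⇒ B) → Prov A → Prov B
  prov-mp (d , e) (d′ , e′) = mp d d′ , mp e e′

  consequence : ∀ {A B} → (∀ v → ev v A ≡ true → ev v B ≡ true) → Prov A → Prov B
  consequence {A} {B} f = prov-mp (prov-taut (⇒-taut {A} {B} f))

  prov-∧ : ∀ {A B} → Prov A → Prov B → Prov (A ∧ₛ B)
  prov-∧ {A} {B} a b = prov-mp (consequence {A} {B ⇒ (A ∧ₛ B)} (λ v eA → ⇒-intro (∧ₛ-intro v A B eA)) a) b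

  consequence₂ : ∀ {A B C} → (∀ v → ev v A ≡ true → ev v B ≡ true → ev v C ≡ true) →
                 Prov A → Prov B → Prov C
  consequence₂ {A} {B} {C} f a b =
    consequence {A ∧ₛ B} {C} (λ v e → let eA , eB = ∧ₛ-elim v A B e in f v eA eB) (prov-∧ {A} {B} a b)

  ⇒-trans : ∀ {A B C} → Prov (A ⇒ B) → Prov (B ⇒ C) → Prov (A ⇒ C)
  ⇒-trans {A} {B} {C} =
    consequence₂ {A ⇒ B} {B ⇒ C} {A ⇒ C} λ v ab bc →
      ⇒-intro {ev v A} λ a → ⇒-elim {ev v B} bc (⇒-elim {ev v A} ab a)

  ⇒-trans₂ : ∀ {A B C D} → Prov (A ⇒ (B ⇒ C)) → Prov (C ⇒ D) → Prov (A ⇒ (B ⇒ D))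
  ⇒-trans₂ {A} {B} {C} {D} =
    consequence₂ {A ⇒ (B ⇒ C)} {C ⇒ D} {A ⇒ (B ⇒ D)} λ v abc cd →
      ⇒-intro {ev v A} λ a → ⇒-intro {ev v B} λ b →
        ⇒-elim {ev v C} cd (⇒-elim {ev v B} (⇒-elim {ev v A} abc a) b)

  prov-id : ∀ A → Prov (A ⇒ A)
  prov-id A = prov-taut {A ⇒ A} (⇒-taut {A} {A} λ _ e → e)

  prov-app : ∀ s t A B → Prov ((s ∶ (A ⇒ B)) ⇒ ((t ∶ A) ⇒ (s · t ∶ B)))
  prov-app s t A B = ⊢-app s t A B , kax (A °) (B °)

  prov-zeroʳ : ∀ t A → Prov ((t · `0 ∶ A) ⇒ (`0 ∶ A))
  -- Both sides have the same modal projection, so K only has to prove an identity.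
  prov-zeroʳ t A = ⊢-zeroʳ A t , proj₂ (prov-id (t ∶ A))

  prov-zeroˡ : ∀ t A → Prov ((`0 · t ∶ A) ⇒ (`0 ∶ A))
  prov-zeroˡ t A = ⊢-zeroˡ A t , proj₂ (prov-id (t ∶ A))

  -- Records why `t` was chosen for `A`. The stored proof or countermodel is reused by the tableau
  -- whenever `t ∶ A` occurs in a later formula.
  Status : Tm → Fm → Set
  Status t A = (Prov A × (T ⊢ (t ∶ A))) ⊎ (t ≡ `0 × Counter A)

  Good : Fm → Set
  Good ⊥ₛ      = ⊤
  Good (atm x) = ⊤
  Good (A ⇒ B) = Good A × Good B
  Good (t ∶ A) = Good A × Status t A

  record Formula (n : ℕ) : Set where
    constructor formula
    field
      fm    : Fm
      good  : Good fm
      small : depth fm < n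

  open Formula

  record Box (n : ℕ) : Set where
    constructor boxed
    field
      term   : Tm
      inner  : Formula n
      status : Status term (fm inner)

    body asserted : Fm
    body = fm inner
    asserted = term ∶ body

  open Box

  -- The term `0` is applied to the terms of `G` one by one, and each product collapses back to `0`.
  zero-⇛ : ∀ {n} (G : List (Box n)) D →
           Prov ((`0 ∶ (map body G ⇛ D)) ⇒ (map asserted G ⇛ (`0 ∶ D)))
  zero-⇛ []      D = prov-id (`0 ∶ D)
  zero-⇛ (b ∷ G) D =
    ⇒-trans₂ {`0 ∶ (body b ⇒ I)} {asserted b} {`0 · term b ∶ I} {R} (prov-app `0 (term b) (body b) I)
      (⇒-trans {`0 · term b ∶ I} {`0 ∶ I} {R} (prov-zeroˡ (term b) I) (zero-⇛ G D))
    where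
    I R : Fm
    I = map body G ⇛ D
    R = map asserted G ⇛ (`0 ∶ D)

  -- The product grows from `u` until it meets the `0` in `G`; there it collapses, and `zero-⇛`
  -- consumes the remaining terms.
  absorb-⇛ : ∀ {n} {G : List (Box n)} → Any (λ b → term b ≡ `0) G → ∀ u D →
             Prov ((u ∶ (map body G ⇛ D)) ⇒ (map asserted G ⇛ (`0 ∶ D)))
  absorb-⇛ {G = boxed _ b _ ∷ G} (here refl) u D =
    ⇒-trans₂ {u ∶ (fm b ⇒ I)} {`0 ∶ fm b} {u · `0 ∶ I} {R} (prov-app u `0 (fm b) I)
      (⇒-trans {u · `0 ∶ I} {`0 ∶ I} {R} (prov-zeroʳ u I) (zero-⇛ G D))
    where
    I R : Fm
    I = map body G ⇛ D
    R = map asserted G ⇛ (`0 ∶ D)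
  absorb-⇛ {G = b ∷ G} (there z) u D =
    ⇒-trans₂ {u ∶ (body b ⇒ I)} {asserted b} {u · term b ∶ I} {R} (prov-app u (term b) (body b) I)
      (absorb-⇛ z (u · term b) D)
    where
    I R : Fm
    I = map body G ⇛ D
    R = map asserted G ⇛ (`0 ∶ D)

  -- Tableau search

  Constraint : Set₁
  Constraint = Valuation → Set

  -- A closed tableau is condensed into one provable formula that excludes `X` propositionally.
  -- Branches can then be combined by reasoning about valuations, without expressing `X` as a
  -- formula.
  Refuted : Constraint → Set
  Refuted X = Σ Fm λ F → Prov F × (∀ v → ev v F ≡ true → ¬ X v)

  Outcome : Constraint → Set
  Outcome X = Refuted X ⊎ Σ Model λ M → X (val M)

  refuted-by : ∀ {X} → (∀ v → ¬ X v) → Refuted X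
  refuted-by ¬x = (⊥ₛ ⇒ ⊥ₛ) , prov-id ⊥ₛ , λ v _ → ¬x v

  weakenRefuted : ∀ {X Y} → (∀ v → Y v → X v) → Refuted X → Refuted Y
  weakenRefuted f (F , d , ¬x) = F , d , λ v e y → ¬x v e (f v y)

  mapOutcome : ∀ {X Y} → (∀ v → Y v → X v) → (∀ v → X v → Y v) → Outcome X → Outcome Y
  mapOutcome f g (inj₁ r)       = inj₁ (weakenRefuted f r)
  mapOutcome f g (inj₂ (M , x)) = inj₂ (M , g (val M) x)

  either : ∀ {X Y Z} → (∀ v → Z v → X v ⊎ Y v) → (∀ v → X v → Z v) → (∀ v → Y v → Z v) →
           Outcome X → Outcome Y → Outcome Z
  either split f g (inj₂ (M , x)) _ = inj₂ (M , f (val M) x)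
  either split f g (inj₁ _) (inj₂ (M , y)) = inj₂ (M , g (val M) y)
  either {X} {Y} {Z} split f g (inj₁ (F , d , ¬x)) (inj₁ (F′ , d′ , ¬y)) =
    inj₁ ((F ∧ₛ F′) , prov-∧ {F} {F′} d d′ , λ v e z →
      let e₁ , e₂ = ∧ₛ-elim v F F′ e in case v e₁ e₂ (split v z))
    where
    case : ∀ v → ev v F ≡ true → ev v F′ ≡ true → X v ⊎ Y v → ⊥
    case v e₁ e₂ (inj₁ x) = ¬x v e₁ x
    case v e₁ e₂ (inj₂ y) = ¬y v e₂ y

  Sequent : ∀ {n} → List (Formula n) → Formula n → Constraint
  Sequent Γ D v = All (λ C → ev v (fm C) ≡ true) Γ × ev v (fm D) ≡ false

  Decider : ℕ → Set
  Decider n = ∀ (Γ : List (Formula n)) D → Outcome (Sequent Γ D)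

  record Literals (n : ℕ) : Set where
    constructor literals
    field
      pos neg : List ℕ
      trueBoxes falseBoxes : List (Box n)

  open Literals

  _⊨_ : ∀ {n} → Valuation → Literals n → Set
  (p , q) ⊨ L = All (λ x → p x ≡ true) (pos L) × All (λ x → p x ≡ false) (neg L) ×
                All (λ b → q (term b) (body b) ≡ true) (trueBoxes L) ×
                All (λ b → q (term b) (body b) ≡ false) (falseBoxes L)

  -- Leaves of the tableau: successor worlds for the false boxes

  module Leaf {n : ℕ} (decide : Decider n) where

    BoxSequent : List (Box n) → Box n → Constraint
    BoxSequent G d v = All (λ b → ev v (asserted b) ≡ true) G × ev v (asserted d) ≡ false

    zero-or-proved : (G : List (Box n)) → Any (λ b → term b ≡ `0) G ⊎ All (λ b → Prov (body b)) G
    zero-or-proved [] = inj₂ []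
    zero-or-proved (b ∷ G) with status b | zero-or-proved G
    ... | inj₂ (z , _) | _      = inj₁ (here z)
    ... | inj₁ _       | inj₁ a = inj₁ (there a)
    ... | inj₁ (d , _) | inj₂ a = inj₂ (d ∷ a)

    refute-box : ∀ {G} d → term d ≡ `0 → Any (λ b → term b ≡ `0) G →
                 Refuted (Sequent (map inner G) (inner d)) → Refuted (BoxSequent G d)
    refute-box {G} d@(boxed _ D _) refl z (F , prf , ¬x) =
      H , prov-mp {u ∶ I} {H} (absorb-⇛ z u (fm D)) (u⊢ , nec (proj₂ provI)) ,
      λ v e (g , ¬d) → true≢false (⇛-elim (map asserted G) e (map⁺ g)) ¬d
      where
      I H : Fm
      I = map body G ⇛ fm D
      H = map asserted G ⇛ (`0 ∶ fm D)

      refute : ∀ v → ev v F ≡ true → All (λ A → ev v A ≡ true) (map body G) → ev v (fm D) ≡ true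
      refute v e g with ev v (fm D) in eq
      ... | true  = refl
      -- The round trip through `G` reindexes `g` from `map body G` to `map inner G`.
      ... | false = ⊥-elim (¬x v e (map⁺ (map⁻ g) , eq))

      provI : Prov I
      provI = consequence {F} {I} (λ v e → ⇛-intro (map body G) (refute v e)) prf

      u : Tm
      u = proj₁ (internalize (proj₁ provI))

      u⊢ : T ⊢ (u ∶ I)
      u⊢ = proj₂ (internalize (proj₁ provI))

    successor : ∀ G d → Refuted (BoxSequent G d) ⊎
                (Σ Model λ M → All (λ b → holds M (body b °) ≡ true) G × holds M (body d °) ≡ false)
    successor G d with status d
    -- The assertion `asserted d` is itself provable, so it cannot be false.
    ... | inj₁ ((_ , ⊢ₖ) , ⊢d) = inj₁ (asserted d , (⊢d , nec ⊢ₖ) , λ v e (_ , ¬d) → true≢false e ¬d)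
    ... | inj₂ (z , M , ¬d) with zero-or-proved G
    -- The stored countermodel of the body of `d` suffices: the bodies in `G` are theorems of K and
    -- hold in it.
    ...   | inj₂ g = inj₂ (M , All.map (λ b → sound M (proj₂ b)) g , trans (sym (ev-val M (body d))) ¬d)
    -- Some term in `G` is `0`, so its body may fail in `M`; a search one level lower looks for a
    -- suitable world.
    ...   | inj₁ a with decide (map inner G) (inner d)
    ...     | inj₁ r = inj₁ (refute-box d z a r)
    ...     | inj₂ (M′ , g , ¬d′) =
                inj₂ (M′ , All.map (λ {b} e → trans (sym (ev-val M′ (body b))) e) (map⁻ g) ,
                      trans (sym (ev-val M′ (body d))) ¬d′)

    successors : ∀ G Δ →
      Refuted (λ v → All (λ b → ev v (asserted b) ≡ true) G × All (λ b → ev v (asserted b) ≡ false) Δ) ⊎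
      (Σ Frame λ f → All (λ b → box f (body b °) ≡ true) G × All (λ b → box f (body b °) ≡ false) Δ)
    successors G [] = inj₂ (noWorlds , All.universal (λ _ → refl) G , [])
    successors G (d ∷ Δ) with successor G d | successors G Δ
    ... | inj₁ r | _ = inj₁ (weakenRefuted (λ v (g , δ) → g , All.head δ) r)
    ... | inj₂ _ | inj₁ r = inj₁ (weakenRefuted (λ v (g , δ) → g , All.tail δ) r)
    -- The new world makes `d` false, and boxes that were already false stay false.
    ... | inj₂ (M , g , ¬d) | inj₂ (f , g′ , δ) =
          inj₂ (addWorld M f , All.zipWith (λ (a , b) → ∧-true⁺ a b) (g , g′) ,
                ∧-falseˡ ¬d ∷ All.map ∧-falseʳ δ)

    leaf : (L : Literals n) → Outcome (_⊨ L)
    leaf (literals P N G Δ) with any? (λ x → _∈?_ _≟_ x P) N | successors G Δ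
    ... | yes a | _ = inj₁ (refuted-by λ v (ps , ns , _) →
            let x , x∈N , x∈P = find a in true≢false (All.lookup ps x∈P) (All.lookup ns x∈N))
    ... | no _ | inj₁ r = inj₁ (weakenRefuted (λ v (_ , _ , gs) → gs) r)
    ... | no ¬a | inj₂ (f , g , δ) =
          -- Exactly the atoms listed as positive are true; as the lists do not clash, the negative
          -- ones come out false.
          inj₂ (((λ x → does (_∈?_ _≟_ x P)) , f) ,
                All.tabulate (λ {x} → dec-true (_∈?_ _≟_ x P)) ,
                All.map (λ {x} → dec-false (_∈?_ _≟_ x P)) (¬Any⇒All¬ N ¬a) , g , δ)

  -- Written with a continuation: `k` settles the pending constraint `X` for any extended list of
  -- literals. A branching rule thus runs the rest of the search once on each branch.
  expand : ∀ {n X} b A → Good A → depth A ≤ n →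
           (∀ (L : Literals n) → Outcome (λ v → X v × v ⊨ L)) →
           ∀ (L : Literals n) → Outcome (λ v → ev v A ≡ b × X v × v ⊨ L)
  expand true  ⊥ₛ _ _ k L = inj₁ (refuted-by λ { _ (() , _) })
  expand false ⊥ₛ _ _ k L = mapOutcome (λ v → proj₂) (λ v x → refl , x) (k L)
  expand true (atm x) _ _ k (literals P N G Δ) =
    mapOutcome (λ v (e , y , p , r) → y , e ∷ p , r)
               (λ { v (y , e ∷ p , r) → e , y , p , r })
               (k (literals (x ∷ P) N G Δ))
  expand false (atm x) _ _ k (literals P N G Δ) =
    mapOutcome (λ v (e , y , p , n , r) → y , p , e ∷ n , r)
               (λ { v (y , p , e ∷ n , r) → e , y , p , n , r })
               (k (literals P (x ∷ N) G Δ))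
  expand true (t ∶ A) (g , s) l k (literals P N G Δ) =
    mapOutcome (λ v (e , y , p , n , γ , δ) → y , p , n , e ∷ γ , δ)
               (λ { v (y , p , n , e ∷ γ , δ) → e , y , p , n , γ , δ })
               -- The bound `l` on the depth of `t ∶ A` is literally `depth A < n`, as `Formula n`
               -- requires.
               (k (literals P N (boxed t (formula A g l) s ∷ G) Δ))
  expand false (t ∶ A) (g , s) l k (literals P N G Δ) =
    mapOutcome (λ v (e , y , p , n , γ , δ) → y , p , n , γ , e ∷ δ)
               (λ { v (y , p , n , γ , e ∷ δ) → e , y , p , n , γ , δ })
               (k (literals P N G (boxed t (formula A g l) s ∷ Δ)))
  expand {X = X} true (A ⇒ B) (gA , gB) l k L =
    either split
           (λ v (e , x) → ⇒-trueˡ e , x)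
           (λ v (e , x) → ⇒-intro (λ _ → e) , x)
           (expand false A gA (m⊔n≤o⇒m≤o _ _ l) k L)
           (expand true B gB (m⊔n≤o⇒n≤o (depth A) _ l) k L)
    where
    split : ∀ v → ev v (A ⇒ B) ≡ true × X v × v ⊨ L →
            (ev v A ≡ false × X v × v ⊨ L) ⊎ (ev v B ≡ true × X v × v ⊨ L)
    split v (e , x) with ⇒-true⁻ e
    ... | inj₁ a = inj₁ (a , x)
    ... | inj₂ b = inj₂ (b , x)
  expand {X = X} false (A ⇒ B) (gA , gB) l k L =
    mapOutcome (λ v (e , x , r) → let a , b = ⇒-false⁻ e in a , (b , x) , r)
               (λ v (a , (b , x) , r) → ⇒-false⁺ a b , x , r)
               -- While `A` is expanded, the falsity of `B` joins the pending constraint, and the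
               -- continuation expands `B` next.
               (expand {X = λ v → ev v B ≡ false × X v} true A gA (m⊔n≤o⇒m≤o _ _ l)
                 (λ L′ → mapOutcome (λ v ((b , x) , r) → b , x , r) (λ v (b , x , r) → (b , x) , r)
                           (expand false B gB (m⊔n≤o⇒n≤o (depth A) _ l) k L′))
                 L)

  expandAll : ∀ {n} → Decider n → (Γ : List (Formula (suc n))) (L : Literals n) →
              Outcome (λ v → All (λ C → ev v (fm C) ≡ true) Γ × v ⊨ L)
  expandAll D []      L = mapOutcome (λ v → proj₂) (λ v x → [] , x) (Leaf.leaf D L)
  expandAll D (C ∷ Γ) L =
    mapOutcome (λ { v (e ∷ γ , r) → e , γ , r }) (λ v (e , γ , r) → e ∷ γ , r)
      (expand true (fm C) (good C) (s≤s⁻¹ (small C)) (expandAll D Γ) L)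

  -- Each level removes one layer of boxes: the leaves at `suc n` only ask for sequents of box
  -- bodies, which have depth below `n`.
  decide : ∀ n → Decider n
  decide zero    Γ (formula _ _ ())
  decide (suc n) Γ D =
    mapOutcome (λ v (γ , e) → e , γ , [] , [] , [] , []) (λ v (e , γ , _) → γ , e)
      (expand false (fm D) (good D) (s≤s⁻¹ (small D)) (expandAll (decide n) Γ) (literals [] [] [] []))

  -- The realization

  prove-or-refute : ∀ A → Good A → Prov A ⊎ Counter A
  prove-or-refute A g with decide (suc (depth A)) [] (formula A g ≤-refl)
  ... | inj₂ (M , _ , e) = inj₂ (M , e)
  ... | inj₁ (F , d , ¬x) = inj₁ (consequence {F} {A} holdsA d)
    where
    holdsA : ∀ v → ev v F ≡ true → ev v A ≡ true
    holdsA v e with ev v A in eq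
    ... | true  = refl
    ... | false = ⊥-elim (¬x v e ([] , eq))

  justify : ∀ A → Good A → Σ Tm λ t → Status t A
  justify A g with prove-or-refute A g
  ... | inj₁ d = let t , d′ = internalize (proj₁ d) in t , inj₁ (d , d′)
  ... | inj₂ c = `0 , inj₂ (refl , c)

  -- `Good` is carried along because choosing a term for `□ B` means searching on the realization of
  -- `B`, whose inner boxes must already have a status.
  realize : ∀ B → Σ Fm λ A → A ° ≡ B × Good A
  realize ⊥ₘ       = ⊥ₛ , refl , tt
  realize (atmₘ x) = atm x , refl , tt
  realize (B ⇒ₘ C) =
    let A , eq , g = realize B ; A′ , eq′ , g′ = realize C in
    (A ⇒ A′) , cong₂ _⇒ₘ_ eq eq′ , g , g′
  realize (□ B) =
    let A , eq , g = realize B ; t , s = justify A g in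
    (t ∶ A) , cong □_ eq , g , s

  realize-theorem : ∀ B → ⊢K B → T ⊢ proj₁ (realize B)
  realize-theorem B d with realize B
  ... | A , refl , g with prove-or-refute A g
  ...   | inj₁ (d′ , _) = d′
  -- A countermodel of the realization is one of `B`, against the soundness of K.
  ...   | inj₂ c        = ⊥-elim (Counter⇒⊬K c d)

mainTheorem3 : (T : Theory) → AxiomaticallyAppropriate T → Schematic T → SupportsWeakening T →
    Σ (MFm → Fm) λ r → IsRealization r × (∀ A → ⊢K A → T ⊢ r A)
mainTheorem3 T appropriate _ _ =
  (λ B → proj₁ (realize B)) , (λ B → proj₁ (proj₂ (realize B))) , realize-theorem
  where open Realization T appropriate
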